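{- Let $q$ be a prime power, let $v, t$ be positive integers, and let $k>t$ be an integer. Let $\mathcal{P}$ be a non-trivial vector space $t$-partition of $\mathbb{F}_q^v$ such that $\mathcal{P}$ contains no element of dimension $i$ for any integer $i$ with $t<i<k$. Then the set $\mathcal{N}$ of all $t$-dimensional elements of $\mathcal{P}$ is $q^{k-t}$-divisible.
   Context: A vector space $t$-partition of $\mathbb{F}_q^v$ is a set $\mathcal{P}$ of subspaces of $\mathbb{F}_q^v$, all of dimension at least $t$, such that every $t$-dimensional subspace of $\mathbb{F}_q^v$ is contained in exactly one element of $\mathcal{P}$. It is called trivial if every element of $\mathcal{P}$ has dimension $t$ or $v$; otherwise it is non-trivial. A $t$-subspace is a $t$-dimensional subspace, and a hyperplane of $\mathbb{F}_q^v$ is a $(v-1)$-dimensional subspace. A set $\mathcal{C}$ of $t$-subspaces of $\mathbb{F}_q^v$ (possibly empty) is called $q^r$-divisible if $\#\mathcal{C}\equiv \#\{C\in\mathcal{C} : C\le H\}\pmod{q^r}$ for all hyperplanes $H$ of $\mathbb{F}_q^v$. -}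

module Defs where

open import Algebra.Apartness using (HeytingCommutativeRing; HeytingField)
open import Algebra.Bundles using (CommutativeRing)
open import Data.Fin.Base using (Fin)
open import Data.Nat.Base using (ℕ; _≤_; _<_; _∸_; _^_; ∣_-_∣)
open import Data.Nat.Divisibility using (_∣_)
open import Data.Nat.Primality using (Prime)
open import Data.Product using (∃!)
open import Data.Product.Base using (∃; ∃₂; _×_; _,_; proj₁; swap)
open import Data.Sum.Base using (_⊎_)
open import Data.Vec.Functional using (Vector; zipWith; map; replicate)
open import Function.Base using (_∘_; id)
open import Function.Bundles using (Inverse)
open import Level using (_⊔_; suc)
open import Relation.Binary.Bundles using (Setoid)
open import Relation.Binary.Definitions using (_Respects_)
import Relation.Binary.Construct.On as On
import Relation.Binary.PropositionalEquality.Core as ≡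
open import Relation.Binary.PropositionalEquality.Properties using (setoid)
open import Relation.Unary using (Pred; _⊆_)

import Algebra.Definitions.RawMonoid as RawMonoidDefinitions
import Data.Vec.Functional.Relation.Binary.Equality.Setoid as VectorEquality

IsPrimePower : ℕ → Set
IsPrimePower q = ∃₂ λ p e → Prime p × 0 < e × q ≡.≡ p ^ e

-- Elements are counted up to the equality of the setoid.
HasSize : ∀ {a ℓ} → Setoid a ℓ → ℕ → Set (a ⊔ ℓ)
HasSize S n = Inverse (setoid (Fin n)) S

CongruentMod : ℕ → ℕ → ℕ → Set
CongruentMod n a b = n ∣ ∣ a - b ∣

fieldRing : ∀ {c ℓ₁ ℓ₂} → HeytingField c ℓ₁ ℓ₂ → CommutativeRing c ℓ₁
fieldRing F = HeytingCommutativeRing.commutativeRing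
  (HeytingField.heytingCommutativeRing F)

-- When the carrier is finite, the apartness of a Heyting field is just the
-- negation of its equality, so a Heyting field of size q is a field with q
-- elements in the usual sense.
fieldSetoid : ∀ {c ℓ₁ ℓ₂} → HeytingField c ℓ₁ ℓ₂ → Setoid c ℓ₁
fieldSetoid F = CommutativeRing.setoid (fieldRing F)

module VectorSpace {c ℓ₁ ℓ₂} (F : HeytingField c ℓ₁ ℓ₂) (v : ℕ) where

  open CommutativeRing (fieldRing F)
    using (Carrier; _≈_; _+_; _*_; 0#; +-rawMonoid)
  open RawMonoidDefinitions +-rawMonoid using (sum)
  open VectorEquality (fieldSetoid F) public using (_≋_)

  V : Set c
  V = Vector Carrier v

  infixl 6 _+ᵛ_
  _+ᵛ_ : V → V → V
  _+ᵛ_ = zipWith _+_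

  infixr 7 _*ᵛ_
  _*ᵛ_ : Carrier → V → V
  a *ᵛ x = map (a *_) x

  0ᵛ : V
  0ᵛ = replicate v 0#

  linComb : ∀ {d} → Vector Carrier d → Vector V d → V
  linComb a b j = sum (λ i → a i * b i j)

  record Subspace : Set (suc (c ⊔ ℓ₁)) where
    field
      Member    : Pred V (c ⊔ ℓ₁)
      resp      : Member Respects _≋_
      0-closed  : Member 0ᵛ
      +-closed  : ∀ {x y} → Member x → Member y → Member (x +ᵛ y)
      *-closed  : ∀ a {x} → Member x → Member (a *ᵛ x)

  open Subspace public using (Member)

  infix 4 _⊑_ _≐_

  _⊑_ : Subspace → Subspace → Set (c ⊔ ℓ₁)
  U ⊑ W = Member U ⊆ Member W

  _≐_ : Subspace → Subspace → Set (c ⊔ ℓ₁)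
  U ≐ W = U ⊑ W × W ⊑ U

  subspaceSetoid : Setoid (suc (c ⊔ ℓ₁)) (c ⊔ ℓ₁)
  subspaceSetoid = record
    { Carrier       = Subspace
    ; _≈_           = _≐_
    ; isEquivalence = record
      { refl  = id , id
      ; sym   = swap
      ; trans = λ (f , f′) (g , g′) → g ∘ f , f′ ∘ g′
      }
    }

  record IsBasis {d} (U : Subspace) (b : Vector V d) : Set (c ⊔ ℓ₁) where
    field
      member      : ∀ i → Member U (b i)
      independent : ∀ a → linComb a b ≋ 0ᵛ → ∀ i → a i ≈ 0#
      spanning    : ∀ {x} → Member U x → ∃ λ a → x ≋ linComb a b

  HasDim : Subspace → ℕ → Set (c ⊔ ℓ₁)
  HasDim U d = ∃ λ (b : Vector V d) → IsBasis U b

  -- The truncated subtraction is only harmless for v > 0.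
  IsHyperplane : Subspace → Set (c ⊔ ℓ₁)
  IsHyperplane H = HasDim H (v ∸ 1)

  -- Sets of subspaces are predicates on subspaces, with members identified
  -- when they have the same vectors; the field extensional of IsPartition
  -- makes the predicate respect this identification.
  members : ∀ {p} → Pred Subspace p → Setoid (suc (c ⊔ ℓ₁) ⊔ p) (c ⊔ ℓ₁)
  members C = On.setoid subspaceSetoid (proj₁ {B = C})

  ofDim : ∀ {p} → Pred Subspace p → ℕ → Pred Subspace (c ⊔ ℓ₁ ⊔ p)
  ofDim P d W = P W × HasDim W d

  within : ∀ {p} → Pred Subspace p → Subspace → Pred Subspace (c ⊔ ℓ₁ ⊔ p)
  within C H W = C W × W ⊑ H

  -- The sizes m and n are determined by C and H.  Asserting their existence
  -- records that the two sets are finite, which is automatic classically.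
  Divisible : ∀ {p} → ℕ → Pred Subspace p → Set (suc (c ⊔ ℓ₁) ⊔ p)
  Divisible Δ C = ∀ H → IsHyperplane H →
    ∃₂ λ m n → HasSize (members C) m × HasSize (members (within C H)) n ×
               CongruentMod Δ m n

  record IsPartition {p} (t : ℕ) (P : Pred Subspace p)
                     : Set (suc (c ⊔ ℓ₁) ⊔ p) where
    field
      extensional : P Respects _≐_
      dimension   : ∀ {U} → P U → ∃ λ d → HasDim U d × t ≤ d
      covers-once : ∀ T → HasDim T t → ∃! _≐_ (λ U → P U × T ⊑ U)

  IsTrivial : ∀ {p} → ℕ → Pred Subspace p → Set (suc (c ⊔ ℓ₁) ⊔ p)
  IsTrivial t P = ∀ {U} → P U → HasDim U t ⊎ HasDim U v

-- Let φ be a linear form with kernel H, let T be a t-dimensional element of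
-- the partition P that is not contained in H, and fix x₀ ∈ T with φ x₀ = 1.
-- For each of the q^v vectors y, the transvection
-- z ↦ z + φ(z) (y - φ(y) x₀) maps T to a t-subspace T_y with T_y ∩ H = T ∩ H,
-- and T_y lies in exactly one element of P.  If an element U of dimension d
-- contains some T_y, then it contains T_y for exactly q^d vectors y.  Hence
-- q^v is the sum of q^d over these U.  All d other than t are at least k, and
-- so is v, because P is non-trivial; so q^t times the number of t-dimensional
-- U is divisible by q^k.  These U are the t-dimensional elements of P that
-- are not contained in H and meet H in T ∩ H, so grouping the t-dimensional
-- elements outside H by their intersection with H proves the theorem.

module Submission where

open import Defs
open import Algebra.Apartness using (HeytingField)
open import Algebra.Bundles using (CommutativeRing)
import Algebra.Properties.Ring as RingProperties
import Algebra.Properties.Semiring.Sum as Sum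
import Algebra.Solver.Ring.NaturalCoefficients.Default as NaturalSolver
open import Data.Bool.Base using (if_then_else_)
open import Data.Fin.Base using (Fin; zero; suc; _↑ˡ_; finToFun; funToFin; combine)
open import Data.Fin.Permutation using (Permutation; permutation)
open import Data.Fin.Properties using
  (any?; all?; ¬∀⟶∃¬; suc-injective; finToFun-funToFin; funToFin-finToFin)
  renaming (_≟_ to _≟ᶠ_)
open import Data.Nat.Base as ℕ using (ℕ; zero; suc; _<_; _≤_; z≤n; _∸_; _^_; ∣_-_∣; NonZero)
open import Data.Nat.Divisibility using
  (_∣_; _∣0; ∣m∣n⇒∣m+n; ∣m+n∣m⇒∣n; *-cancelˡ-∣; divides; n∣m*n; m∣m*n)
open import Data.Nat.Primality using (prime⇒nonTrivial)
import Data.Nat.Properties as ℕ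
open import Data.Product.Base using (∃; _×_; _,_; proj₁; proj₂)
open import Data.Sum.Base using (inj₁)
open import Data.Unit.Base using (tt)
open import Data.Vec.Functional using (Vector; _∷_; head; tail)
import Data.Vec.Functional.Relation.Binary.Equality.Setoid as VectorEquality
open import Function.Base using (_∘_; id)
open import Function.Bundles using (Inverse)
open import Level using (Level; _⊔_) renaming (suc to lsuc)
open import Relation.Binary.Bundles using (Setoid)
open import Relation.Binary.Core using (Rel)
open import Relation.Binary.Definitions using (_Respects_; tri<; tri≈; tri>)
import Relation.Binary.PropositionalEquality as ≡
open ≡ using (_≡_; _≢_; _≗_)
import Relation.Binary.Reasoning.Setoid as SetoidReasoning
open import Relation.Binary.Structures using (IsDecEquivalence)
open import Relation.Nullary.Decidable using
  (Dec; yes; no; does; _×-dec_; _→-dec_; ¬?; map′; dec-true; dec-false; decidable-stable)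
open import Relation.Nullary.Negation using (¬_; contradiction)
open import Relation.Unary using (Pred; Decidable)

open Sum ℕ.+-*-semiring using
  (sum; sum-syntax; sum-cong-≗; sum-replicate-zero; sum-permute; ∑-comm; ∑-distrib-+; *-distribˡ-sum)

-- Finite sums and counting

private
  variable
    ℓ ℓ′ : Level
    A : Set ℓ
    B : Set ℓ′
    m n : ℕ

-- The Iverson bracket. Cardinalities are handled as sums of such brackets over `Fin n`.
⟦_⟧ : Dec A → ℕ
⟦ a? ⟧ = if does a? then 1 else 0

⟦⟧-true : (a? : Dec A) → A → ⟦ a? ⟧ ≡ 1
⟦⟧-true a? a rewrite dec-true a? a = ≡.refl

⟦⟧-false : (a? : Dec A) → ¬ A → ⟦ a? ⟧ ≡ 0
⟦⟧-false a? ¬a rewrite dec-false a? ¬a = ≡.refl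

⟦⟧-cong : (a? : Dec A) (b? : Dec B) → (A → B) → (B → A) → ⟦ a? ⟧ ≡ ⟦ b? ⟧
⟦⟧-cong (yes a) b? f g = ≡.sym (⟦⟧-true b? (f a))
⟦⟧-cong (no ¬a) b? f g = ≡.sym (⟦⟧-false b? (¬a ∘ g))

⟦⟧-mono : (a? : Dec A) (b? : Dec B) → (A → B) → ⟦ a? ⟧ ≤ ⟦ b? ⟧
⟦⟧-mono (yes a) b? f = ℕ.≤-reflexive (≡.sym (⟦⟧-true b? (f a)))
⟦⟧-mono (no _)  b? f = z≤n

⟦⟧-reflect : (a? : Dec A) (b? : Dec B) → ⟦ a? ⟧ ≤ ⟦ b? ⟧ → A → B
⟦⟧-reflect (yes a) (yes b) _ _ = b
⟦⟧-reflect (no ¬a) _       _ a = contradiction a ¬a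

⟦⟧-≤1 : (a? : Dec A) → ⟦ a? ⟧ ≤ 1
⟦⟧-≤1 (yes _) = ℕ.≤-refl
⟦⟧-≤1 (no _)  = z≤n

⟦⟧-× : (a? : Dec A) (b? : Dec B) → ⟦ a? ×-dec b? ⟧ ≡ ⟦ a? ⟧ ℕ.* ⟦ b? ⟧
⟦⟧-× (yes a) b? = ≡.sym (ℕ.*-identityˡ _)
⟦⟧-× (no ¬a) b? = ≡.refl

⟦⟧-split : (a? : Dec A) (b? : Dec B) → ⟦ a? ⟧ ≡ ⟦ a? ×-dec b? ⟧ ℕ.+ ⟦ a? ×-dec ¬? b? ⟧
⟦⟧-split (no _)  _       = ≡.refl
⟦⟧-split (yes _) (yes _) = ≡.refl
⟦⟧-split (yes _) (no _)  = ≡.refl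

^-split : ∀ q {m n} → m ≤ n → q ^ n ≡ q ^ m ℕ.* q ^ (n ∸ m)
^-split q {m} {n} m≤n =
  ≡.trans (≡.cong (q ^_) (≡.sym (ℕ.m+[n∸m]≡n m≤n))) (ℕ.^-distribˡ-+-* q m (n ∸ m))

^-∣-^ : ∀ q {m n} → m ≤ n → q ^ m ∣ q ^ n
^-∣-^ q {m} {n} m≤n = ≡.subst (q ^ m ∣_) (≡.sym (^-split q m≤n)) (m∣m*n (q ^ (n ∸ m)))

sum-zero : (f : Vector ℕ n) → (∀ i → f i ≡ 0) → sum f ≡ 0
sum-zero {n} f f≗0 = ≡.trans (sum-cong-≗ f≗0) (sum-replicate-zero n)

sum-one : ∀ n → ∑[ i < n ] 1 ≡ n
sum-one zero    = ≡.refl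
sum-one (suc n) = ≡.cong suc (sum-one n)

sum-≟ : (i : Fin n) → ∑[ j < n ] ⟦ i ≟ᶠ j ⟧ ≡ 1
sum-≟ {suc n} zero    = ≡.cong suc (sum-zero {n} _ λ _ → ≡.refl)
sum-≟ {suc n} (suc i) =
  ≡.trans (sum-cong-≗ {n} λ j → ⟦⟧-cong (suc i ≟ᶠ suc j) (i ≟ᶠ j) suc-injective (≡.cong suc)) (sum-≟ i)

sum-unique : {Q : Pred (Fin n) ℓ} (Q? : Decidable Q) (i : Fin n) → Q i →
             (∀ {j} → Q j → i ≡ j) → ∑[ j < n ] ⟦ Q? j ⟧ ≡ 1
sum-unique {n} {Q = Q} Q? i q unique = ≡.trans
  (sum-cong-≗ {n} λ j → ⟦⟧-cong (Q? j) (i ≟ᶠ j) unique (λ i≡j → ≡.subst Q i≡j q)) (sum-≟ i)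

sum-mono : (f g : Vector ℕ n) → (∀ i → f i ≤ g i) → sum f ≤ sum g
sum-mono {zero}  f g f≤g = z≤n
sum-mono {suc n} f g f≤g = ℕ.+-mono-≤ (f≤g zero) (sum-mono (f ∘ suc) (g ∘ suc) (f≤g ∘ suc))

-- Turns equal cardinalities into equal sets: with brackets as terms, an inclusion between finite
-- sets of the same size is an equality. A strict inequality in one term could not be made up in the
-- others.
sum-tight : (f g : Vector ℕ n) → (∀ i → f i ≤ g i) → sum g ≤ sum f → ∀ i → g i ≤ f i
sum-tight {suc n} f g f≤g g≤f zero = ℕ.+-cancelʳ-≤ _ _ _
  (ℕ.≤-trans g≤f (ℕ.+-monoʳ-≤ (f zero) (sum-mono _ _ (f≤g ∘ suc))))
sum-tight {suc n} f g f≤g g≤f (suc i) = sum-tight (f ∘ suc) (g ∘ suc) (f≤g ∘ suc)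
  (ℕ.+-cancelˡ-≤ (g zero) _ _ (ℕ.≤-trans g≤f (ℕ.+-monoˡ-≤ _ (f≤g zero)))) i

∣-sum : ∀ {d} (f : Vector ℕ n) → (∀ i → d ∣ f i) → d ∣ sum f
∣-sum {zero}  f d∣f = _ ∣0
∣-sum {suc n} f d∣f = ∣m∣n⇒∣m+n (d∣f zero) (∣-sum (f ∘ suc) (d∣f ∘ suc))

-- Classes of a decidable equivalence and enumeration of decidable subsets

record Quotient {n} (_~_ : Rel (Fin n) ℓ) : Set ℓ where
  field
    size      : ℕ
    class     : Fin n → Fin size
    rep       : Fin size → Fin n
    class-rep : ∀ k → class (rep k) ≡ k
    sound     : ∀ {i j} → i ~ j → class i ≡ class j
    complete  : ∀ {i j} → class i ≡ class j → i ~ j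

quotient : {_~_ : Rel (Fin n) ℓ} → IsDecEquivalence _~_ → Quotient _~_
quotient {zero} _ = record
  { size = 0 ; class = λ () ; rep = λ () ; class-rep = λ ()
  ; sound = λ { {()} } ; complete = λ { {()} } }
-- Once the tail has been classified, `zero` joins the class of an equivalent representative if
-- there is one, and opens a new class otherwise.
quotient {suc n} {_~_ = _~_} E = extend (any? λ k → zero ≟ suc (rep k))
  where
  open IsDecEquivalence E

  suc-isDecEquivalence : IsDecEquivalence (λ i j → suc i ~ suc j)
  suc-isDecEquivalence = record
    { isEquivalence = record { refl = refl ; sym = sym ; trans = trans }
    ; _≟_ = λ i j → suc i ≟ suc j
    }

  open Quotient (quotient suc-isDecEquivalence)

  extend : Dec (∃ λ k → zero ~ suc (rep k)) → Quotient _~_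
  extend (yes (k , 0~k)) = record
    { size = size ; class = class′ ; rep = suc ∘ rep ; class-rep = class-rep
    ; sound = sound′ _ _ ; complete = complete′ _ _ }
    where
    class′ : Fin (suc n) → Fin size
    class′ zero    = k
    class′ (suc i) = class i

    zero-sound : ∀ {j} → zero ~ suc j → k ≡ class j
    zero-sound 0~j = ≡.trans (≡.sym (class-rep k)) (sound (trans (sym 0~k) 0~j))

    zero-complete : ∀ {j} → k ≡ class j → zero ~ suc j
    zero-complete k≡j = trans 0~k (complete (≡.trans (class-rep k) k≡j))

    sound′ : ∀ i j → i ~ j → class′ i ≡ class′ j
    sound′ zero    zero    i~j = ≡.refl
    sound′ zero    (suc j) i~j = zero-sound i~j
    sound′ (suc i) zero    i~j = ≡.sym (zero-sound (sym i~j))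
    sound′ (suc i) (suc j) i~j = sound i~j

    complete′ : ∀ i j → class′ i ≡ class′ j → i ~ j
    complete′ zero    zero    eq = refl
    complete′ zero    (suc j) eq = zero-complete eq
    complete′ (suc i) zero    eq = sym (zero-complete (≡.sym eq))
    complete′ (suc i) (suc j) eq = complete eq
  extend (no new) = record
    { size = suc size ; class = class′ ; rep = rep′ ; class-rep = class-rep′
    ; sound = sound′ _ _ ; complete = complete′ _ _ }
    where
    class′ : Fin (suc n) → Fin (suc size)
    class′ zero    = zero
    class′ (suc i) = suc (class i)

    rep′ : Fin (suc size) → Fin (suc n)
    rep′ zero    = zero
    rep′ (suc k) = suc (rep k)

    class-rep′ : ∀ k → class′ (rep′ k) ≡ k
    class-rep′ zero    = ≡.refl
    class-rep′ (suc k) = ≡.cong suc (class-rep k)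

    ¬0~ : ∀ {j} → ¬ zero ~ suc j
    ¬0~ {j} 0~j = new (class j , trans 0~j (complete (≡.sym (class-rep (class j)))))

    sound′ : ∀ i j → i ~ j → class′ i ≡ class′ j
    sound′ zero    zero    i~j = ≡.refl
    sound′ zero    (suc j) i~j = contradiction i~j ¬0~
    sound′ (suc i) zero    i~j = contradiction (sym i~j) ¬0~
    sound′ (suc i) (suc j) i~j = ≡.cong suc (sound i~j)

    complete′ : ∀ i j → class′ i ≡ class′ j → i ~ j
    complete′ zero    zero    eq = refl
    complete′ (suc i) (suc j) eq = complete (suc-injective eq)

-- The count splits as the sum over all classes of the counts inside them. The hypothesis concerns
-- only the classes that meet `W`; the others contribute 0.
∣-sum-classes : ∀ {d} {_~_ : Rel (Fin n) ℓ} (E : IsDecEquivalence _~_) →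
                {W : Pred (Fin n) ℓ′} (W? : Decidable W) →
                let open IsDecEquivalence E in
                (∀ i → W i → d ∣ ∑[ j < n ] ⟦ W? j ×-dec (i ≟ j) ⟧) →
                d ∣ ∑[ j < n ] ⟦ W? j ⟧
∣-sum-classes {n} {d = d} {_~_} E {W} W? d∣class =
  ≡.subst (d ∣_) (≡.sym split) (∣-sum {size} _ d∣fibre)
  where
  open IsDecEquivalence E using (_≟_)
  open Quotient (quotient E)

  split : ∑[ j < n ] ⟦ W? j ⟧ ≡ ∑[ k < size ] ∑[ j < n ] ⟦ W? j ×-dec (class j ≟ᶠ k) ⟧
  split = ≡.trans (sum-cong-≗ {n} λ j → ≡.sym (begin
      ∑[ k < size ] ⟦ W? j ×-dec (class j ≟ᶠ k) ⟧   ≡⟨ sum-cong-≗ {size} (λ k → ⟦⟧-× (W? j) (class j ≟ᶠ k)) ⟩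
      ∑[ k < size ] (⟦ W? j ⟧ ℕ.* ⟦ class j ≟ᶠ k ⟧)   ≡⟨ *-distribˡ-sum {size} ⟦ W? j ⟧ _ ⟨
      ⟦ W? j ⟧ ℕ.* ∑[ k < size ] ⟦ class j ≟ᶠ k ⟧     ≡⟨ ≡.cong (⟦ W? j ⟧ ℕ.*_) (sum-≟ (class j)) ⟩
      ⟦ W? j ⟧ ℕ.* 1                                 ≡⟨ ℕ.*-identityʳ _ ⟩
      ⟦ W? j ⟧                                     ∎)) (∑-comm {n} {size} _)
    where open ≡.≡-Reasoning

  d∣fibre : ∀ k → d ∣ ∑[ j < n ] ⟦ W? j ×-dec (class j ≟ᶠ k) ⟧
  d∣fibre k with any? (λ j → W? j ×-dec (class j ≟ᶠ k))
  ... | no empty = ≡.subst (d ∣_) (≡.sym (sum-zero {n} _ λ j →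
          ⟦⟧-false (W? j ×-dec (class j ≟ᶠ k)) (λ w → empty (j , w)))) (d ∣0)
  ... | yes (i , w , ≡.refl) = ≡.subst (d ∣_) (sum-cong-≗ {n} λ j →
          ⟦⟧-cong (W? j ×-dec (i ≟ j)) (W? j ×-dec (class j ≟ᶠ class i))
            (λ (w′ , i~j) → w′ , ≡.sym (sound i~j)) (λ (w′ , eq) → w′ , complete (≡.sym eq)))
          (d∣class i w)

-- `index` takes a proof of `W i`, but by `at-index` and `injective` its value depends on `i` alone.
record Enumeration {n} (W : Pred (Fin n) ℓ) (m : ℕ) : Set ℓ where
  field
    at        : Fin m → Fin n
    injective : ∀ {i j} → at i ≡ at j → i ≡ j
    sound     : ∀ k → W (at k)
    index     : ∀ {i} → W i → Fin m
    at-index  : ∀ {i} (w : W i) → at (index w) ≡ i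

enumerate : {W : Pred (Fin n) ℓ} (W? : Decidable W) → Enumeration W (∑[ i < n ] ⟦ W? i ⟧)
enumerate {zero} W? = record
  { at = λ () ; injective = λ { {()} } ; sound = λ () ; index = λ { {()} } ; at-index = λ { {()} } }
enumerate {suc n} {W = W} W? with W? zero | enumerate (W? ∘ suc)
... | no ¬w0 | E = record
  { at        = suc ∘ at
  ; injective = injective ∘ suc-injective
  ; sound     = sound
  ; index     = λ {i} → index′ i
  ; at-index  = λ {i} → at-index′ i
  }
  where
  open Enumeration E
  index′ : ∀ i → W i → Fin _
  index′ zero    w = contradiction w ¬w0
  index′ (suc i) w = index w

  at-index′ : ∀ i w → suc (at (index′ i w)) ≡ i
  at-index′ zero    w = contradiction w ¬w0
  at-index′ (suc i) w = ≡.cong suc (at-index w)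
... | yes w0 | E = record
  { at        = at′
  ; injective = injective′ _ _
  ; sound     = λ { zero → w0 ; (suc k) → sound k }
  ; index     = λ {i} → index′ i
  ; at-index  = λ {i} → at-index′ i
  }
  where
  open Enumeration E
  at′ : Fin (suc _) → Fin (suc n)
  at′ zero    = zero
  at′ (suc k) = suc (at k)

  injective′ : ∀ i j → at′ i ≡ at′ j → i ≡ j
  injective′ zero    zero    eq = ≡.refl
  injective′ zero    (suc j) ()
  injective′ (suc i) zero    ()
  injective′ (suc i) (suc j) eq = ≡.cong suc (injective (suc-injective eq))

  index′ : ∀ i → W i → Fin (suc _)
  index′ zero    w = zero
  index′ (suc i) w = suc (index w)

  at-index′ : ∀ i w → at′ (index′ i w) ≡ i
  at-index′ zero    w = ≡.refl
  at-index′ (suc i) w = ≡.cong suc (at-index w)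

-- Finite setoids: vectors and exhaustive search

funToFin-cong : {f g : Fin m → Fin n} → f ≗ g → funToFin f ≡ funToFin g
funToFin-cong {zero}  f≗g = ≡.refl
funToFin-cong {suc m} f≗g = ≡.cong₂ combine (f≗g zero) (funToFin-cong (f≗g ∘ suc))

module _ {S : Setoid ℓ ℓ′} {q} (S-size : HasSize S q) where

  open Setoid S
  open Inverse S-size
  open VectorEquality S using (≋-setoid)

  vector-size : ∀ n → HasSize (≋-setoid n) (q ^ n)
  vector-size n = record
    { to        = λ k → to ∘ finToFun {q} {n} k
    ; from      = λ x → funToFin (from ∘ x)
    ; to-cong   = λ { ≡.refl _ → refl }
    ; from-cong = λ x≋y → funToFin-cong (from-cong ∘ x≋y)
    ; inverse   = (λ { ≡.refl i → trans (reflexive (≡.cong to (finToFun-funToFin _ i))) (strictlyInverseˡ _) })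
                , λ {k} eq → ≡.trans (funToFin-cong λ i → inverseʳ (eq i)) (funToFin-finToFin {n} {q} k)
    }

  ≈-dec : ∀ x y → Dec (x ≈ y)
  ≈-dec x y = map′
    (λ eq → trans (sym (strictlyInverseˡ x)) (inverseˡ eq)) from-cong (from x ≟ᶠ from y)

  module _ {p} {Q : Pred Carrier p} (Q-resp : Q Respects _≈_) (Q? : Decidable Q) where

    -- Only the representatives `to i` are tested; `Q-resp` transfers the outcome to every element
    -- equal to one of them.
    any-dec : Dec (∃ Q)
    any-dec = map′ (λ (i , p) → to i , p) (λ (x , p) → from x , Q-resp (sym (strictlyInverseˡ x)) p)
      (any? (Q? ∘ to))

    all-dec : Dec (∀ x → Q x)
    all-dec = map′ (λ p x → Q-resp (strictlyInverseˡ x) (p (from x))) (λ p i → p (to i))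
      (all? (Q? ∘ to))

-- Linear algebra over a finite field

module LinearAlgebra {c ℓ₁ ℓ₂} (F : HeytingField c ℓ₁ ℓ₂) (v : ℕ) where

  open VectorSpace F v
  open CommutativeRing (fieldRing F) hiding (zero)
  open RingProperties ring using (-‿distribˡ-*; x∙y⁻¹≈ε⇒x≈y)
  open VectorEquality (fieldSetoid F) using (≋-setoid)
  open Setoid (≋-setoid v) public using () renaming (sym to ≋-sym; trans to ≋-trans)
  private module ∑ = Sum semiring

  linComb-cong : ∀ {d} {a a′ : Vector Carrier d} {b b′ : Vector V d} →
                 a ≋ a′ → (∀ i → b i ≋ b′ i) → linComb a b ≋ linComb a′ b′
  linComb-cong a≋a′ b≋b′ j = ∑.sum-cong-≋ λ i → *-cong (a≋a′ i) (b≋b′ i j)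

  linComb-congˡ : ∀ {d} {a a′ : Vector Carrier d} (b : Vector V d) → a ≋ a′ → linComb a b ≋ linComb a′ b
  linComb-congˡ b a≋a′ = linComb-cong {b = b} a≋a′ (λ _ _ → refl)

  linComb-0 : ∀ {d} (b : Vector V d) → linComb (λ _ → 0#) b ≋ 0ᵛ
  linComb-0 {d} b j = trans (∑.sum-cong-≋ {d} λ i → zeroˡ (b i j)) (∑.sum-replicate-zero d)

  linComb-+ : ∀ {d} (a a′ : Vector Carrier d) (b : Vector V d) →
              linComb (λ i → a i + a′ i) b ≋ linComb a b +ᵛ linComb a′ b
  linComb-+ {d} a a′ b j = trans
    (∑.sum-cong-≋ {d} λ i → distribʳ (b i j) (a i) (a′ i))
    (∑.∑-distrib-+ {d} (λ i → a i * b i j) (λ i → a′ i * b i j))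

  linComb-* : ∀ {d} s (a : Vector Carrier d) (b : Vector V d) →
              linComb (λ i → s * a i) b ≋ s *ᵛ linComb a b
  linComb-* {d} s a b j = trans
    (∑.sum-cong-≋ {d} λ i → *-assoc s (a i) (b i j))
    (sym (∑.*-distribˡ-sum {d} s (λ i → a i * b i j)))

  unit : ∀ {d} → Fin d → Vector Carrier d
  unit zero    = 1# ∷ λ _ → 0#
  unit (suc i) = 0# ∷ unit i

  linComb-unit : ∀ {d} i (b : Vector V d) → linComb (unit i) b ≋ b i
  linComb-unit zero    b j = trans (+-cong (*-identityˡ _) (linComb-0 (tail b) j)) (+-identityʳ _)
  linComb-unit (suc i) b j = trans (+-cong (zeroˡ _) (linComb-unit i (tail b) j)) (+-identityˡ _)

  linComb∈ : ∀ {d} U (a : Vector Carrier d) {b : Vector V d} → (∀ i → Member U (b i)) → Member U (linComb a b)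
  linComb∈ {zero}  U a b∈U = Subspace.0-closed U
  linComb∈ {suc d} U a b∈U =
    Subspace.+-closed U (Subspace.*-closed U (head a) (b∈U zero)) (linComb∈ U (tail a) (b∈U ∘ suc))

  record IsLinear (f : V → V) : Set (c ⊔ ℓ₁) where
    field
      cong   : ∀ {x y} → x ≋ y → f x ≋ f y
      +-homo : ∀ x y → f (x +ᵛ y) ≋ f x +ᵛ f y
      *-homo : ∀ s x → f (s *ᵛ x) ≋ s *ᵛ f x

    linComb-homo : ∀ {d} (a : Vector Carrier d) (b : Vector V d) → f (linComb a b) ≋ linComb a (f ∘ b)
    -- The empty combination is the zero vector, which equals `0# *ᵛ 0ᵛ`, so `*-homo` shows that `f`
    -- sends it to zero.
    linComb-homo {zero} a b = ≋-trans (cong λ _ → sym (zeroˡ 0#)) (≋-trans (*-homo 0# 0ᵛ) λ _ → zeroˡ _)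
    linComb-homo {suc d} a b = ≋-trans (+-homo _ _) λ j →
      +-cong (*-homo (a zero) (b zero) j) (linComb-homo (tail a) (tail b) j)

  Independent : ∀ {d} → Vector V d → Set (c ⊔ ℓ₁)
  Independent b = ∀ a → linComb a b ≋ 0ᵛ → ∀ i → a i ≈ 0#

  -- The difference of the coefficient vectors gives a linear relation. It is formed with the scalar
  -- `- 1#` so that `linComb-+` and `linComb-*` apply.
  linComb-injective : ∀ {d} {b : Vector V d} → Independent b →
                      ∀ a a′ → linComb a b ≋ linComb a′ b → a ≋ a′
  linComb-injective {b = b} ind a a′ eq i = x∙y⁻¹≈ε⇒x≈y _ _
    (trans (+-congˡ (trans (-‿cong (sym (*-identityˡ _))) (-‿distribˡ-* _ _))) (ind _ zero-comb i))
    where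
    zero-comb : linComb (λ k → a k + - 1# * a′ k) b ≋ 0ᵛ
    zero-comb j = begin
      linComb (λ k → a k + - 1# * a′ k) b j        ≈⟨ linComb-+ a _ b j ⟩
      linComb a b j + linComb (λ k → - 1# * a′ k) b j  ≈⟨ +-cong (eq j) (linComb-* (- 1#) a′ b j) ⟩
      linComb a′ b j + - 1# * linComb a′ b j        ≈⟨ +-congˡ (-‿distribˡ-* _ _) ⟨
      linComb a′ b j + - (1# * linComb a′ b j)      ≈⟨ +-congˡ (-‿cong (*-identityˡ _)) ⟩
      linComb a′ b j + - linComb a′ b j             ≈⟨ -‿inverseʳ _ ⟩
      0#                                           ∎
      where open SetoidReasoning setoid

  span : ∀ {d} → Vector V d → Subspace
  span b = record
    { Member   = λ x → ∃ λ a → x ≋ linComb a b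
    ; resp     = λ x≋y (a , eq) → a , ≋-trans (≋-sym x≋y) eq
    ; 0-closed = (λ _ → 0#) , ≋-sym (linComb-0 b)
    ; +-closed = λ (a , eq) (a′ , eq′) → (λ i → a i + a′ i) ,
        λ j → trans (+-cong (eq j) (eq′ j)) (sym (linComb-+ a a′ b j))
    ; *-closed = λ s (a , eq) → (λ i → s * a i) ,
        λ j → trans (*-congˡ (eq j)) (sym (linComb-* s a b j))
    }

  span-isBasis : ∀ {d} {b : Vector V d} → Independent b → IsBasis (span b) b
  span-isBasis {b = b} ind = record
    { member      = λ i → unit i , ≋-sym (linComb-unit i b)
    ; independent = ind
    ; spanning    = id
    }

  basis-⊑ : ∀ {d T} U {b : Vector V d} → IsBasis T b → (∀ i → Member U (b i)) → T ⊑ U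
  basis-⊑ U B b∈U x∈T =
    let a , eq = IsBasis.spanning B x∈T in Subspace.resp U (≋-sym eq) (linComb∈ U a b∈U)

  ⊑-basis : ∀ {d T} U {b : Vector V d} → IsBasis T b → T ⊑ U → ∀ i → Member U (b i)
  ⊑-basis U B T⊑U i = T⊑U (IsBasis.member B i)

  HasDim-resp : ∀ {U W d} → U ≐ W → HasDim U d → HasDim W d
  HasDim-resp (U⊑W , W⊑U) (b , B) = b , record
    { member = U⊑W ∘ B.member ; independent = B.independent ; spanning = B.spanning ∘ W⊑U }
    where module B = IsBasis B

  record LinearForm : Set (c ⊔ ℓ₁) where
    field
      ⟨_⟩    : V → Carrier
      cong   : ∀ {x y} → x ≋ y → ⟨ x ⟩ ≈ ⟨ y ⟩
      +-homo : ∀ x y → ⟨ x +ᵛ y ⟩ ≈ ⟨ x ⟩ + ⟨ y ⟩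
      *-homo : ∀ s x → ⟨ s *ᵛ x ⟩ ≈ s * ⟨ x ⟩

    0-homo : ⟨ 0ᵛ ⟩ ≈ 0#
    0-homo = trans (cong λ _ → sym (zeroˡ 0#)) (trans (*-homo 0# 0ᵛ) (zeroˡ _))

    IsKernel : Subspace → Set (c ⊔ ℓ₁)
    IsKernel H = (∀ {x} → Member H x → ⟨ x ⟩ ≈ 0#) × (∀ {x} → ⟨ x ⟩ ≈ 0# → Member H x)

-- Dimension by counting vectors

module FiniteSpace {c ℓ₁ ℓ₂} (F : HeytingField c ℓ₁ ℓ₂) {q} (1<q : 1 < q)
                   (F-size : HasSize (fieldSetoid F) q) (v : ℕ) where

  open VectorSpace F v
  open LinearAlgebra F v
  open CommutativeRing (fieldRing F) hiding (zero)
  open VectorEquality (fieldSetoid F) using (≋-setoid)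

  V-size : HasSize (≋-setoid v) (q ^ v)
  V-size = vector-size F-size v

  open Inverse V-size public using ()
    renaming (to to vec; from to code; strictlyInverseˡ to vec-code; inverseʳ to code-vec)

  _≋?_ : (x y : V) → Dec (x ≋ y)
  _≋?_ = ≈-dec V-size

  _≈?_ : (x y : Carrier) → Dec (x ≈ y)
  _≈?_ = ≈-dec F-size

  -- Tightness only refutes ¬ (x # 0#), so the inverse is found by searching the finite field.
  inverse : ∀ x → ¬ x ≈ 0# → ∃ λ y → y * x ≈ 1#
  inverse x x≉0 = decidable-stable
    (any-dec F-size (λ y≈z yx≈1 → trans (*-congʳ (sym y≈z)) yx≈1) (λ y → (y * x) ≈? 1#))
    λ none → x≉0 (proj₁ (HeytingField.tight F x 0#) λ x#0 →
      let y , yx≈1 , _ = HeytingField.#⇒invertible F x#0 in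
      none (y , trans (*-congˡ (sym x-0≈x)) yx≈1))
    where
    x-0≈x : x - 0# ≈ x
    x-0≈x = trans (+-congˡ (RingProperties.-0#≈0# ring)) (+-identityʳ x)

  module _ {U d} (U-dim : HasDim U d) where

    private
      b : Vector V d
      b = proj₁ U-dim

      open module Coefficients = Inverse (vector-size F-size d) using ()
        renaming (to to coeffs; from to coeffs-code;
                  strictlyInverseˡ to coeffs-code-inverse; inverseʳ to code-coeffs-inverse)

      module B = IsBasis (proj₂ U-dim)

    -- All `q ^ d` coefficient vectors are tried.
    member? : Decidable (Member U)
    member? x = map′
      (λ (a , eq) → Subspace.resp U (≋-sym eq) (linComb∈ U a B.member)) B.spanning
      (any-dec (vector-size F-size d)
        (λ a≋a′ eq → ≋-trans eq (linComb-congˡ b a≋a′)) (λ a → x ≋? linComb a b))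

    -- Double counting of the pairs of a vector and a coefficient vector that represents it. Each
    -- coefficient vector represents one vector; a vector of `U` has exactly one representation, any
    -- other vector none. `U?` is a parameter so that `dim-unique` can evaluate the same sum with
    -- two bases.
    cardinality : (U? : Decidable (Member U)) → ∑[ i < q ^ v ] ⟦ U? (vec i) ⟧ ≡ q ^ d
    cardinality U? = begin
      ∑[ i < q ^ v ] ⟦ U? (vec i) ⟧                                         ≡⟨ sum-cong-≗ row ⟩
      ∑[ i < q ^ v ] ∑[ a < q ^ d ] ⟦ vec i ≋? linComb (coeffs a) b ⟧       ≡⟨ ∑-comm {q ^ v} {q ^ d} _ ⟩
      ∑[ a < q ^ d ] ∑[ i < q ^ v ] ⟦ vec i ≋? linComb (coeffs a) b ⟧       ≡⟨ sum-cong-≗ column ⟩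
      ∑[ a < q ^ d ] 1                                                     ≡⟨ sum-one (q ^ d) ⟩
      q ^ d                                                                ∎
      where
      open ≡.≡-Reasoning
      column : ∀ a → ∑[ i < q ^ v ] ⟦ vec i ≋? linComb (coeffs a) b ⟧ ≡ 1
      column a = sum-unique (λ i → vec i ≋? linComb (coeffs a) b) (code (linComb (coeffs a) b))
        (vec-code _) (λ eq → code-vec (≋-sym eq))

      row : ∀ i → ⟦ U? (vec i) ⟧ ≡ ∑[ a < q ^ d ] ⟦ vec i ≋? linComb (coeffs a) b ⟧
      row i with U? (vec i)
      ... | no x∉U = ≡.sym (sum-zero {q ^ d} _ λ a → ⟦⟧-false (vec i ≋? linComb (coeffs a) b)
              λ eq → x∉U (Subspace.resp U (≋-sym eq) (linComb∈ U (coeffs a) B.member)))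
      ... | yes x∈U = let a , eq = B.spanning x∈U in ≡.sym (sum-unique
              (λ k → vec i ≋? linComb (coeffs k) b) (coeffs-code a)
              (≋-trans eq (linComb-congˡ b λ k → sym (coeffs-code-inverse a k)))
              λ {k} eq′ → code-coeffs-inverse (linComb-injective B.independent a (coeffs k) (≋-trans (≋-sym eq) eq′)))

  -- Counting takes the place of the exchange lemma, here and in the next three results: since
  -- `1 < q`, the number `q ^ d` of vectors grows strictly with `d` and determines it.
  dim-≤ : ∀ {U d} → HasDim U d → d ≤ v
  dim-≤ {U} {d} D = ℕ.≮⇒≥ λ v<d → ℕ.<⇒≱ (ℕ.^-monoʳ-< q 1<q v<d) (begin
    q ^ d                                     ≡⟨ cardinality D (member? D) ⟨
    ∑[ i < q ^ v ] ⟦ member? D (vec i) ⟧       ≤⟨ sum-mono {q ^ v} _ _ (λ i → ⟦⟧-≤1 (member? D (vec i))) ⟩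
    ∑[ i < q ^ v ] 1                          ≡⟨ sum-one (q ^ v) ⟩
    q ^ v                                     ∎)
    where open ℕ.≤-Reasoning

  dim-unique : ∀ {U d e} → HasDim U d → HasDim U e → d ≡ e
  dim-unique {U} {d} {e} D E =
    ^-injective (≡.trans (≡.sym (cardinality D (member? D))) (cardinality E (member? D)))
    where
    ^-injective : q ^ d ≡ q ^ e → d ≡ e
    ^-injective eq with ℕ.<-cmp d e
    ... | tri< d<e _ _ = contradiction eq (ℕ.<⇒≢ (ℕ.^-monoʳ-< q 1<q d<e))
    ... | tri≈ _ d≡e _ = d≡e
    ... | tri> _ _ e<d = contradiction (≡.sym eq) (ℕ.<⇒≢ (ℕ.^-monoʳ-< q 1<q e<d))

  full-dim : ∀ {U} → HasDim U v → ∀ x → Member U x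
  -- The bracket of `yes tt` computes to the constant 1 with which `sum-tight` compares the
  -- indicator of `U`; both sums equal `q ^ v`.
  full-dim {U} D x = Subspace.resp U (vec-code x) (⟦⟧-reflect (yes tt) (member? D (vec (code x)))
    (sum-tight {q ^ v} (λ i → ⟦ member? D (vec i) ⟧) (λ _ → 1) (λ i → ⟦⟧-≤1 (member? D (vec i)))
      (ℕ.≤-reflexive (≡.trans (sum-one (q ^ v)) (≡.sym (cardinality D (member? D))))) (code x))
    tt)

  ⊑-same-dim : ∀ {T U d} → HasDim T d → HasDim U d → T ⊑ U → U ⊑ T
  ⊑-same-dim {T} {U} T-dim U-dim T⊑U {x} x∈U = Subspace.resp T (vec-code x)
    (⟦⟧-reflect (member? U-dim (vec (code x))) (member? T-dim (vec (code x)))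
      (sum-tight {q ^ v} (λ i → ⟦ member? T-dim (vec i) ⟧) (λ i → ⟦ member? U-dim (vec i) ⟧)
        (λ i → ⟦⟧-mono (member? T-dim (vec i)) (member? U-dim (vec i)) T⊑U)
        (ℕ.≤-reflexive (≡.trans (cardinality U-dim (member? U-dim))
          (≡.sym (cardinality T-dim (member? T-dim)))))
        (code x))
      (Subspace.resp U (≋-sym (vec-code x)) x∈U))

  -- Testing a basis of `T` reduces the inclusion to finitely many membership questions.
  ⊑-dec : ∀ {T d U} → HasDim T d → Decidable (Member U) → Dec (T ⊑ U)
  ⊑-dec {T} {U = U} (b , B) U? =
    map′ (λ p {x} → basis-⊑ {T = T} U B p) (⊑-basis {T = T} U B) (all? (U? ∘ b))

  independent? : ∀ {d} → Decidable (Independent {d})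
  independent? {d} b = all-dec (vector-size F-size d)
    (λ a≋a′ p eq i → trans (sym (a≋a′ i)) (p (≋-trans (linComb-congˡ b a≋a′) eq) i))
    (λ a → (linComb a b ≋? 0ᵛ) →-dec all? (λ i → a i ≈? 0#))

-- Hyperplanes as kernels of linear forms

module Hyperplanes {c ℓ₁ ℓ₂} (F : HeytingField c ℓ₁ ℓ₂) {q} (1<q : 1 < q)
                   (F-size : HasSize (fieldSetoid F) q) (v : ℕ) where

  open VectorSpace F v
  open LinearAlgebra F v
  open FiniteSpace F 1<q F-size v
  open CommutativeRing (fieldRing F) hiding (zero)
  open RingProperties ring using (+-inverseˡ-unique; -1*x≈-x; -‿involutive)
  open SetoidReasoning setoid

  -- If the coefficient of `x` in a relation were nonzero, the relation could be solved for `x`,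
  -- which would then lie in `U`.
  ∷-independent : ∀ {U d x} ((b , B) : HasDim U d) → ¬ Member U x → Independent (x ∷ b)
  ∷-independent {U} {x = x} (b , B) x∉U a eq with a zero ≈? 0#
  ... | yes a₀≈0 = λ
    { zero    → a₀≈0
    ; (suc i) → IsBasis.independent B (tail a) (λ j → begin
        linComb (tail a) b j               ≈⟨ +-identityˡ _ ⟨
        0# + linComb (tail a) b j          ≈⟨ +-congʳ (trans (*-congʳ a₀≈0) (zeroˡ (x j))) ⟨
        a zero * x j + linComb (tail a) b j ≈⟨ eq j ⟩
        0#                                 ∎) i }
  ... | no a₀≉0 = contradiction (Subspace.resp U (λ j → sym (x≈ j))
      (Subspace.*-closed U a₀⁻¹ (Subspace.*-closed U (- 1#) (linComb∈ U (tail a) (IsBasis.member B))))) x∉U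
    where
    a₀⁻¹ = proj₁ (inverse (a zero) a₀≉0)
    x≈ : ∀ j → x j ≈ a₀⁻¹ * (- 1# * linComb (tail a) b j)
    x≈ j = begin
      x j                                      ≈⟨ *-identityˡ _ ⟨
      1# * x j                                 ≈⟨ *-congʳ (proj₂ (inverse (a zero) a₀≉0)) ⟨
      a₀⁻¹ * a zero * x j                       ≈⟨ *-assoc _ _ _ ⟩
      a₀⁻¹ * (a zero * x j)                     ≈⟨ *-congˡ (+-inverseˡ-unique _ _ (eq j)) ⟩
      a₀⁻¹ * - linComb (tail a) b j             ≈⟨ *-congˡ (-1*x≈-x _) ⟨
      a₀⁻¹ * (- 1# * linComb (tail a) b j)      ∎

  -- If `U` contained every vector, it would have `q ^ v` elements and not `q ^ d`. Finite search
  -- turns this contradiction into a witness.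
  proper : ∀ {U d} → HasDim U d → d < v → ∃ λ x → ¬ Member U x
  proper {U} {d} D d<v = decidable-stable (any-dec V-size
      (λ x≋y x∉U y∈U → x∉U (Subspace.resp U (≋-sym x≋y) y∈U)) (λ x → ¬? (member? D x)))
    λ none → ℕ.<⇒≢ (ℕ.^-monoʳ-< q 1<q d<v) (≡.trans (≡.sym (cardinality D (member? D)))
      (≡.trans (sum-cong-≗ {q ^ v} λ i → ⟦⟧-true (member? D (vec i))
        (decidable-stable (member? D (vec i)) λ x∉U → none (vec i , x∉U))) (sum-one (q ^ v))))

  -- By cardinality e together with a basis of H spans V; the form is the coordinate at e.
  coordinate-form : ∀ {H d e} → suc d ≡ v → HasDim H d → ¬ Member H e → ∃ λ L → LinearForm.IsKernel L H
  coordinate-form {H} {d} {e} 1+d≡v D@(h , Bh) e∉H = record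
      { ⟨_⟩    = λ x → coords x zero
      ; cong   = λ {x} {y} x≋y → unique (coords x) (coords y)
          (≋-trans (≋-sym (coords-eq x)) (≋-trans x≋y (coords-eq y))) zero
      ; +-homo = λ x y → unique (coords (x +ᵛ y)) (λ i → coords x i + coords y i)
          (≋-trans (≋-sym (coords-eq (x +ᵛ y))) λ j →
            trans (+-cong (coords-eq x j) (coords-eq y j)) (sym (linComb-+ (coords x) (coords y) b j))) zero
      ; *-homo = λ s x → unique (coords (s *ᵛ x)) (λ i → s * coords x i)
          (≋-trans (≋-sym (coords-eq (s *ᵛ x))) λ j →
            trans (*-congˡ (coords-eq x j)) (sym (linComb-* s (coords x) b j))) zero
      }
    , (λ {x} x∈H → let a , eq = IsBasis.spanning Bh x∈H in
        unique (coords x) (0# ∷ a) (≋-trans (≋-sym (coords-eq x)) λ j →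
          trans (eq j) (sym (trans (+-congʳ (zeroˡ _)) (+-identityˡ _)))) zero)
    , λ {x} φx≈0 → Subspace.resp H
        (λ j → sym (trans (coords-eq x j) (trans (+-congʳ (trans (*-congʳ φx≈0) (zeroˡ _))) (+-identityˡ _))))
        (linComb∈ H (tail (coords x)) (IsBasis.member Bh))
    where
    b : Vector V (suc d)
    b = e ∷ h

    ind : Independent b
    ind = ∷-independent D e∉H

    unique : ∀ a a′ → linComb a b ≋ linComb a′ b → a ≋ a′
    unique = linComb-injective {b = b} ind

    total : ∀ x → Member (span b) x
    total = full-dim {span b} (≡.subst (HasDim (span b)) 1+d≡v (b , span-isBasis {b = b} ind))

    coords : V → Vector Carrier (suc d)
    coords x = proj₁ (total x)

    coords-eq : ∀ x → x ≋ linComb (coords x) b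
    coords-eq x = proj₂ (total x)

  hyperplane-form : ∀ {H} → 0 < v → IsHyperplane H → ∃ λ L → LinearForm.IsKernel L H
  hyperplane-form 0<v D =
    -- For `v` equal to 0 the truncated `v ∸ 1` would be `v` itself and no vector could lie outside;
    -- `0 < v` excludes this.
    let 1+[v∸1]≡v = ℕ.m+[n∸m]≡n 0<v
        _ , e∉H = proper D (ℕ.≤-reflexive 1+[v∸1]≡v)
    in coordinate-form 1+[v∸1]≡v D e∉H

  -- Some basis vector of `U` lies outside the kernel, and it is scaled by the inverse of its value.
  form≈1 : ∀ L {H U d} → LinearForm.IsKernel L H → HasDim U d → ¬ U ⊑ H →
           ∃ λ u → Member U u × LinearForm.⟨_⟩ L u ≈ 1#
  form≈1 L {H} {U} {d} (_ , φ≈0⇒H) (b , B) U⋢H =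
    let i , φbᵢ≉0 = ¬∀⟶∃¬ d (λ i → ⟨ b i ⟩ ≈ 0#) (λ i → ⟨ b i ⟩ ≈? 0#)
                      (λ φb≈0 → U⋢H λ {x} → basis-⊑ H B (φ≈0⇒H ∘ φb≈0) {x})
        s , sφ≈1 = inverse ⟨ b i ⟩ φbᵢ≉0
    in s *ᵛ b i , Subspace.*-closed U s (IsBasis.member B i) , trans (*-homo s (b i)) sφ≈1
    where open LinearForm L

  -- Transvections that fix the hyperplane pointwise

  module Transvections (L : LinearForm) {T t} {b : Vector V t} (B : IsBasis T b)
                       {x₀} (x₀∈T : Member T x₀) (φx₀≈1 : LinearForm.⟨_⟩ L x₀ ≈ 1#) where

    open LinearForm L renaming (⟨_⟩ to φ)
    open NaturalSolver commutativeSemiring using (solve; _:=_; _:+_; _:*_)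

    -- The projection onto the kernel of `φ` along `x₀`. Each kernel vector is the image of exactly
    -- q vectors, so letting `y` run over all of `V` only multiplies every count by q.
    shift : V → V
    shift y = y +ᵛ (- φ y) *ᵛ x₀

    φ-shift : ∀ y → φ (shift y) ≈ 0#
    φ-shift y = begin
      φ (y +ᵛ (- φ y) *ᵛ x₀)     ≈⟨ +-homo _ _ ⟩
      φ y + φ ((- φ y) *ᵛ x₀)    ≈⟨ +-congˡ (*-homo _ _) ⟩
      φ y + - φ y * φ x₀         ≈⟨ +-congˡ (trans (*-congˡ φx₀≈1) (*-identityʳ _)) ⟩
      φ y + - φ y                ≈⟨ -‿inverseʳ _ ⟩
      0#                         ∎

    τ : V → V → V
    τ y z = z +ᵛ φ z *ᵛ shift y

    τ-linear : ∀ y → IsLinear (τ y)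
    τ-linear y = record
      { cong   = λ x≋z j → +-cong (x≋z j) (*-congʳ (cong x≋z))
      ; +-homo = λ x z j → trans (+-congˡ (*-congʳ (+-homo x z)))
          (solve 5 (λ x z f g w → (x :+ z) :+ (f :+ g) :* w := (x :+ f :* w) :+ (z :+ g :* w))
            refl (x j) (z j) (φ x) (φ z) (shift y j))
      ; *-homo = λ s x j → trans (+-congˡ (*-congʳ (*-homo s x)))
          (solve 4 (λ s x f w → s :* x :+ (s :* f) :* w := s :* (x :+ f :* w))
            refl s (x j) (φ x) (shift y j))
      }

    φ-τ : ∀ y z → φ (τ y z) ≈ φ z
    φ-τ y z = begin
      φ (z +ᵛ φ z *ᵛ shift y)    ≈⟨ +-homo _ _ ⟩
      φ z + φ (φ z *ᵛ shift y)   ≈⟨ +-congˡ (*-homo _ _) ⟩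
      φ z + φ z * φ (shift y)    ≈⟨ +-congˡ (trans (*-congˡ (φ-shift y)) (zeroʳ _)) ⟩
      φ z + 0#                   ≈⟨ +-identityʳ _ ⟩
      φ z                        ∎

    τ-fixes : ∀ y {z} → φ z ≈ 0# → τ y z ≋ z
    τ-fixes y φz≈0 j = trans (+-congˡ (trans (*-congʳ φz≈0) (zeroˡ _))) (+-identityʳ _)

    τT : V → Subspace
    τT y = span (τ y ∘ b)

    -- The map `τ y` is injective: a vector that it sends to zero has value 0 under `φ` by `φ-τ`,
    -- hence is fixed, hence is zero.
    τT-dim : ∀ y → HasDim (τT y) t
    τT-dim y = τ y ∘ b , span-isBasis λ a eq →
      let τ≋0 : τ y (linComb a b) ≋ 0ᵛ
          τ≋0 = ≋-trans (IsLinear.linComb-homo (τ-linear y) a b) eq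
          φ≈0 : φ (linComb a b) ≈ 0#
          φ≈0 = trans (sym (φ-τ y _)) (trans (cong τ≋0) 0-homo)
      in IsBasis.independent B a (≋-trans (≋-sym (τ-fixes y φ≈0)) τ≋0)

    τ∈τT : ∀ y {z} → Member T z → Member (τT y) (τ y z)
    τ∈τT y z∈T = let a , eq = IsBasis.spanning B z∈T in
      a , ≋-trans (IsLinear.cong (τ-linear y) eq) (IsLinear.linComb-homo (τ-linear y) a b)

    T∩ker⊑τT : ∀ y {z} → Member T z → φ z ≈ 0# → Member (τT y) z
    T∩ker⊑τT y z∈T φz≈0 = Subspace.resp (τT y) (τ-fixes y φz≈0) (τ∈τT y z∈T)

    -- Here `z` is the image of some vector of `T`. As `τ y` preserves `φ`, that vector is in the
    -- kernel too, so it is fixed and equals `z`. Together with `T∩ker⊑τT`, the spaces `T` and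
    -- `τT y` meet the kernel in the same vectors.
    τT∩ker⊑T : ∀ y {z} → Member (τT y) z → φ z ≈ 0# → Member T z
    τT∩ker⊑T y {z} (a , eq) φz≈0 = Subspace.resp T
      (≋-sym (≋-trans eq′ (τ-fixes y (trans (sym (φ-τ y _)) (trans (sym (cong eq′)) φz≈0)))))
      (linComb∈ T a (IsBasis.member B))
      where
      eq′ : z ≋ τ y (linComb a b)
      eq′ = ≋-trans eq (≋-sym (IsLinear.linComb-homo (τ-linear y) a b))

    -- This is `τ y x₀` with `φ x₀` replaced by its value 1. Together with the kernel vectors of `T`
    -- it spans `τT y`, so it is the only vector on which containment of `τT y` has to be tested.
    point : V → V
    point y = x₀ +ᵛ shift y

    point∈τT : ∀ y → Member (τT y) (point y)
    point∈τT y = Subspace.resp (τT y)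
      (λ j → +-congˡ (trans (*-congʳ φx₀≈1) (*-identityˡ _))) (τ∈τT y x₀∈T)

    φ-point : ∀ y → φ (point y) ≈ 1#
    φ-point y = trans (+-homo _ _) (trans (+-cong φx₀≈1 (φ-shift y)) (+-identityʳ _))

    τT⊑ : ∀ U y → (∀ {z} → Member T z → φ z ≈ 0# → Member U z) → Member U (point y) → τT y ⊑ U
    τT⊑ U y T∩ker⊑U point∈U (a , eq) = Subspace.resp U (≋-sym eq) (linComb∈ U a λ i →
      Subspace.resp U (λ j → split (b i j) (φ (b i)) (x₀ j) (shift y j))
        (Subspace.+-closed U
          -- The generator `τ y (b i)` is split as `shift (b i)`, which lies in `T` and in the
          -- kernel, plus `φ (b i)` times `point y`.
          (T∩ker⊑U (Subspace.+-closed T (IsBasis.member B i) (Subspace.*-closed T (- φ (b i)) x₀∈T))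
                   (φ-shift (b i)))
          (Subspace.*-closed U (φ (b i)) point∈U)))
      where
      split : ∀ β f ξ w → (β + - f * ξ) + f * (ξ + w) ≈ β + f * w
      split β f ξ w = begin
        (β + - f * ξ) + f * (ξ + w)
          ≈⟨ solve 5 (λ β f n ξ w → (β :+ n :* ξ) :+ f :* (ξ :+ w) := (β :+ f :* w) :+ (n :+ f) :* ξ)
               refl β f (- f) ξ w ⟩
        (β + f * w) + (- f + f) * ξ   ≈⟨ +-congˡ (trans (*-congʳ (-‿inverseˡ f)) (zeroˡ ξ)) ⟩
        (β + f * w) + 0#              ≈⟨ +-identityʳ _ ⟩
        β + f * w                     ∎

    -- As y runs over V, the point x₀ + shift y lies in U exactly when
    -- y + (φ y - 1) (u - x₀) does, and the latter runs over V bijectively.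
    τT-count : ∀ {U d u} (U-dim : HasDim U d) → (∀ {z} → Member T z → φ z ≈ 0# → Member U z) →
               Member U u → φ u ≈ 1# → (τT⊑U? : ∀ y → Dec (τT y ⊑ U)) →
               ∑[ i < q ^ v ] ⟦ τT⊑U? (vec i) ⟧ ≡ q ^ d
    τT-count {U} {d} {u} U-dim T∩ker⊑U u∈U φu≈1 τT⊑U? = ≡.trans
      (sum-cong-≗ {q ^ v} λ i →
        ⟦⟧-cong (τT⊑U? (vec i)) (U? (vec (code (g (vec i))))) (to (vec i)) (from (vec i)))
      (≡.trans (≡.sym (sum-permute (⟦_⟧ ∘ U? ∘ vec) π)) (cardinality U-dim U?))
      where
      U? : Decidable (Member U)
      U? = member? U-dim

      δ : V
      δ = u +ᵛ - 1# *ᵛ x₀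

      φδ≈0 : φ δ ≈ 0#
      φδ≈0 = begin
        φ (u +ᵛ - 1# *ᵛ x₀)       ≈⟨ +-homo _ _ ⟩
        φ u + φ (- 1# *ᵛ x₀)      ≈⟨ +-cong φu≈1 (*-homo _ _) ⟩
        1# + - 1# * φ x₀          ≈⟨ +-congˡ (trans (*-congˡ φx₀≈1) (*-identityʳ _)) ⟩
        1# + - 1#                 ≈⟨ -‿inverseʳ _ ⟩
        0#                        ∎

      κ : V → Carrier
      κ y = φ y + - 1#

      g g⁻¹ : V → V
      g   y = y +ᵛ κ y *ᵛ δ
      g⁻¹ y = y +ᵛ (- κ y) *ᵛ δ

      -- Since `δ` lies in the kernel, adding multiples of it changes neither `φ` nor `κ`; this
      -- makes `g⁻¹` inverse to `g`.
      φ-+δ : ∀ y s → φ (y +ᵛ s *ᵛ δ) ≈ φ y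
      φ-+δ y s = trans (+-homo _ _) (trans
        (+-congˡ (trans (*-homo _ _) (trans (*-congˡ φδ≈0) (zeroʳ _)))) (+-identityʳ _))

      cancel : ∀ a s s′ d → s + s′ ≈ 0# → (a + s * d) + s′ * d ≈ a
      cancel a s s′ d s+s′≈0 = begin
        (a + s * d) + s′ * d
          ≈⟨ solve 4 (λ a s s′ d → (a :+ s :* d) :+ s′ :* d := a :+ (s :+ s′) :* d) refl a s s′ d ⟩
        a + (s + s′) * d        ≈⟨ +-congˡ (trans (*-congʳ s+s′≈0) (zeroˡ d)) ⟩
        a + 0#                  ≈⟨ +-identityʳ a ⟩
        a                       ∎

      g∘g⁻¹ : ∀ y → g (g⁻¹ y) ≋ y
      g∘g⁻¹ y j = cancel (y j) (- κ y) (κ (g⁻¹ y)) (δ j)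
        (trans (+-congˡ (+-congʳ (φ-+δ y _))) (-‿inverseˡ _))

      g⁻¹∘g : ∀ y → g⁻¹ (g y) ≋ y
      g⁻¹∘g y j = cancel (y j) (κ y) (- κ (g y)) (δ j)
        (trans (+-congˡ (-‿cong (+-congʳ (φ-+δ y _)))) (-‿inverseʳ _))

      +δ-cong : ∀ {x y s s′} → x ≋ y → s ≈ s′ → x +ᵛ s *ᵛ δ ≋ y +ᵛ s′ *ᵛ δ
      +δ-cong x≋y s≈s′ j = +-cong (x≋y j) (*-congʳ s≈s′)

      g-cong : ∀ {x y} → x ≋ y → g x ≋ g y
      g-cong {x} {y} x≋y = +δ-cong {x} {y} {κ x} {κ y} x≋y (+-congʳ (cong x≋y))

      g⁻¹-cong : ∀ {x y} → x ≋ y → g⁻¹ x ≋ g⁻¹ y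
      g⁻¹-cong {x} {y} x≋y = +δ-cong {x} {y} { - κ x} { - κ y} x≋y (-‿cong (+-congʳ (cong x≋y)))

      π : Permutation (q ^ v) (q ^ v)
      π = permutation (code ∘ g ∘ vec) (code ∘ g⁻¹ ∘ vec)
        (λ i → code-vec (≋-trans (g-cong (vec-code _)) (g∘g⁻¹ (vec i))))
        (λ i → code-vec (≋-trans (g⁻¹-cong (vec-code _)) (g⁻¹∘g (vec i))))

      -- The solver knows no negation: - 1# is passed to it as a variable n, after
      -- n * n and n * f have been introduced for 1# and - f.
      point-g : ∀ y → point y +ᵛ κ y *ᵛ u ≋ g y
      point-g y j = begin
        (ξ + (η + - f * ξ)) + (f + - 1#) * μ
          ≈⟨ +-congʳ (+-cong (trans (sym (*-identityˡ ξ)) (*-congʳ (sym -1*-1≈1)))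
                             (+-congˡ (*-congʳ (sym (-1*x≈-x f))))) ⟩
        ((- 1# * - 1#) * ξ + (η + (- 1# * f) * ξ)) + (f + - 1#) * μ
          ≈⟨ solve 5 (λ η f n ξ μ → ((n :* n) :* ξ :+ (η :+ (n :* f) :* ξ)) :+ (f :+ n) :* μ
                                    := η :+ (f :+ n) :* (μ :+ n :* ξ)) refl η f (- 1#) ξ μ ⟩
        η + (f + - 1#) * (μ + - 1# * ξ) ∎
        where
        ξ = x₀ j
        η = y j
        f = φ y
        μ = u j
        -1*-1≈1 : - 1# * - 1# ≈ 1#
        -1*-1≈1 = trans (-1*x≈-x (- 1#)) (-‿involutive 1#)

      -- By `point-g`, `point y` and `g y` differ by a multiple of `u`, which is in `U`. The round
      -- trip `vec (code _)` is the form in which `sum-permute` along `π` delivers the vector.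
      to : ∀ y → τT y ⊑ U → Member U (vec (code (g y)))
      to y τT⊑U = Subspace.resp U (≋-trans (point-g y) (≋-sym (vec-code _)))
        (Subspace.+-closed U (τT⊑U (point∈τT y)) (Subspace.*-closed U (κ y) u∈U))

      from : ∀ y → Member U (vec (code (g y))) → τT y ⊑ U
      from y gy∈U = τT⊑ U y T∩ker⊑U (Subspace.resp U
        (λ j → trans (+-congʳ (trans (vec-code (g y) j) (sym (point-g y j))))
                     (cancel (point y j) (κ y) (- κ y) (u j) (-‿inverseʳ _)))
        (Subspace.+-closed U gy∈U (Subspace.*-closed U (- κ y) u∈U)))

-- Partitions

module FiniteFamilies {c ℓ₁ ℓ₂} (F : HeytingField c ℓ₁ ℓ₂) {q} (1<q : 1 < q)
    (F-size : HasSize (fieldSetoid F) q) (v : ℕ) where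

  open VectorSpace F v
  open LinearAlgebra F v
  open FiniteSpace F 1<q F-size v
  open CommutativeRing (fieldRing F) hiding (zero)
  open Setoid subspaceSetoid using () renaming (refl to ≐-refl; sym to ≐-sym; trans to ≐-trans)

  -- One representative for each element of `P` up to `≐`, so that sets of elements can be counted
  -- by sums over `Fin size`.
  record FiniteFamily {p} (P : Pred Subspace p) : Set (lsuc (c ⊔ ℓ₁) ⊔ p) where
    field
      size              : ℕ
      element           : Fin size → Subspace
      element∈P         : ∀ i → P (element i)
      element-injective : ∀ {i j} → element i ≐ element j → i ≡ j
      find              : ∀ {U} → P U → ∃ λ i → element i ≐ U

    -- `Q` is the trace of `C` on the list; the lemma converts a sum of brackets into the size that
    -- `Divisible` asks for.
    members-size : ∀ {ℓ ℓ′} (C : Pred Subspace ℓ) {Q : Pred (Fin size) ℓ′} (Q? : Decidable Q) →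
                   (∀ {U} → C U → P U) → (∀ i → Q i → C (element i)) →
                   (∀ {U} i → C U → element i ≐ U → Q i) →
                   HasSize (members C) (∑[ i < size ] ⟦ Q? i ⟧)
    members-size C {Q} Q? C⊆P Q⇒C C⇒Q = record
      { to        = λ k → element (at k) , Q⇒C (at k) (sound k)
      ; from      = λ (_ , U∈C) → from U∈C
      ; to-cong   = λ { {k} ≡.refl → ≐-refl {element (at k)} }
      ; from-cong = λ {x} {y} → from-cong {proj₁ x} {proj₁ y} (proj₂ x) (proj₂ y)
      ; inverse   = (λ { {_ , U∈C} ≡.refl → from-≐ U∈C })
                  , λ { {k} {U , U∈C} U≐k → injective (element-injective
                      (≐-trans {element (at (from U∈C))} {U} {element (at k)} (from-≐ U∈C) U≐k)) }
      }
      where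
      open Enumeration (enumerate Q?)
      from : ∀ {U} → C U → Fin (∑[ i < size ] ⟦ Q? i ⟧)
      from U∈C = let i , i≐U = find (C⊆P U∈C) in index (C⇒Q i U∈C i≐U)

      from-≐ : ∀ {U} (U∈C : C U) → element (at (from U∈C)) ≐ U
      from-≐ {U} U∈C = let i , i≐U = find (C⊆P U∈C) in
        ≡.subst (λ l → element l ≐ U) (≡.sym (at-index (C⇒Q i U∈C i≐U))) i≐U

      from-cong : ∀ {U W} (U∈C : C U) (W∈C : C W) → U ≐ W → from U∈C ≡ from W∈C
      from-cong {U} {W} U∈C W∈C U≐W = injective (element-injective
        (≐-trans {element (at (from U∈C))} {U} {element (at (from W∈C))} (from-≐ U∈C)
          (≐-trans {U} {W} {element (at (from W∈C))} U≐W
            (≐-sym {element (at (from W∈C))} {W} (from-≐ W∈C)))))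

  remove-repetitions : ∀ {p} {P : Pred Subspace p} {n} (f : Fin n → Subspace) → (∀ k → P (f k)) →
                       (∀ {U} → P U → ∃ λ k → f k ≐ U) → (∀ k l → Dec (f k ≐ f l)) → FiniteFamily P
  remove-repetitions {P} f f∈P surjective _≐?_ = record
    { size              = size
    ; element           = f ∘ rep
    ; element∈P         = f∈P ∘ rep
    ; element-injective = λ {i} {j} eq → ≡.trans (≡.sym (class-rep i)) (≡.trans (sound eq) (class-rep j))
    ; find              = λ {U} U∈P → let k , k≐U = surjective U∈P in
        class k , ≐-trans {f (rep (class k))} {f k} {U} (complete (class-rep (class k))) k≐U
    }
    where
    ≐-isDecEquivalence : IsDecEquivalence (λ k l → f k ≐ f l)
    ≐-isDecEquivalence = record
      { isEquivalence = record
        { refl  = λ {k} → ≐-refl {f k}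
        ; sym   = λ {k} {l} → ≐-sym {f k} {f l}
        ; trans = λ {k} {l} {m} → ≐-trans {f k} {f l} {f m}
        }
      ; _≟_ = _≐?_
      }

    open Quotient (quotient ≐-isDecEquivalence)

  padZeros : ∀ {m} e → Vector Carrier m → Vector Carrier (m ℕ.+ e)
  padZeros {zero}  e a = λ _ → 0#
  padZeros {suc m} e a = head a ∷ padZeros e (tail a)

  padZeros-↑ˡ : ∀ {m} e (a : Vector Carrier m) i → padZeros e a (i ↑ˡ e) ≡ a i
  padZeros-↑ˡ e a zero    = ≡.refl
  padZeros-↑ˡ e a (suc i) = padZeros-↑ˡ e (tail a) i

  linComb-padZeros : ∀ {m} e a (b : Vector V (m ℕ.+ e)) → linComb (padZeros e a) b ≋ linComb a (b ∘ (_↑ˡ e))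
  linComb-padZeros {zero}  e a b   = linComb-0 b
  linComb-padZeros {suc m} e a b j = +-congˡ (linComb-padZeros e (tail a) (tail b) j)

  -- A relation among the first `m` vectors becomes a relation among all of them when padded with
  -- zeros.
  independent-↑ˡ : ∀ {m} e {b : Vector V (m ℕ.+ e)} → Independent b → Independent (b ∘ (_↑ˡ e))
  independent-↑ˡ e {b} ind a eq i = trans (reflexive (≡.sym (padZeros-↑ˡ e a i)))
    (ind (padZeros e a) (≋-trans (linComb-padZeros e a b) eq) (i ↑ˡ e))

  independent-resp : ∀ {m} {b b′ : Vector V m} → (∀ i → b i ≋ b′ i) → Independent b → Independent b′
  independent-resp {b = b} {b′} b≋b′ ind a eq =
    ind a (≋-trans (linComb-cong {b = b} {b′} (λ _ → refl) b≋b′) eq)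

  module _ {p} {P : Pred Subspace p} {t} (P-partition : IsPartition t P) where

    open IsPartition P-partition

    cover : ∀ b → Independent {t} b → Subspace
    cover b ind = proj₁ (covers-once (span b) (b , span-isBasis {b = b} ind))

    cover∈P : ∀ b ind → P (cover b ind)
    cover∈P b ind = proj₁ (proj₁ (proj₂ (covers-once (span b) (b , span-isBasis {b = b} ind))))

    cover-unique : ∀ b ind {U} → P U → (∀ i → Member U (b i)) → cover b ind ≐ U
    cover-unique b ind {U} U∈P b∈U = proj₂ (proj₂ (covers-once (span b) (b , span-isBasis {b = b} ind)))
      (U∈P , λ {x} → basis-⊑ {T = span b} U {b} (span-isBasis {b = b} ind) b∈U {x})

    independent-vectors : ∀ {U} → P U → ∃ λ b → Independent {t} b × ∀ i → Member U (b i)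
    independent-vectors U∈P with dimension U∈P
    ... | d , (b , B) , t≤d with ℕ.m≤n⇒∃[o]m+o≡n t≤d
    -- With `d` written as `t + e`, the first `t` vectors of the basis are taken.
    ... | e , ≡.refl = b ∘ (_↑ˡ e) , independent-↑ˡ e {b} (IsBasis.independent B)
                     , λ i → IsBasis.member B (i ↑ˡ e)

    private
      _≐?_ : ∀ {U W} → P U → P W → Dec (U ≐ W)
      _≐?_ {U} {W} U∈P W∈P =
        let _ , U-dim , _ = dimension U∈P
            _ , W-dim , _ = dimension W∈P
        in ⊑-dec {U = W} U-dim (member? W-dim) ×-dec ⊑-dec {U = U} W-dim (member? U-dim)

    module _ {n} (tuples : HasSize (VectorEquality.≋-setoid (VectorEquality.≋-setoid (fieldSetoid F) v) t) n)
             {m} (bases : Enumeration (λ k → Independent (Inverse.to tuples k)) m) where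

      open Inverse tuples using () renaming
        (to to tuple; from to tuple-code; strictlyInverseˡ to tuple-tuple-code)
      open Enumeration bases

      -- An element of `P` has dimension at least `t`, so it contains `t` independent vectors and is
      -- their `cover`. The finitely many independent `t`-tuples therefore reach all of `P`, with
      -- repetitions.
      finiteFamily-from : FiniteFamily P
      finiteFamily-from = remove-repetitions
        (λ k → cover (tuple (at k)) (sound k)) (λ k → cover∈P (tuple (at k)) (sound k))
        surjective (λ k l → cover∈P (tuple (at k)) (sound k) ≐? cover∈P (tuple (at l)) (sound l))
        where
        surjective : ∀ {U} → P U → ∃ λ k → cover (tuple (at k)) (sound k) ≐ U
        surjective {U} U∈P = k , cover-unique (tuple (at k)) (sound k) U∈P λ i →
            Subspace.resp U (≋-sym (tuple≋b i)) (b∈U i)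
          where
          b = proj₁ (independent-vectors U∈P)
          b∈U = proj₂ (proj₂ (independent-vectors U∈P))

          ind : Independent (tuple (tuple-code b))
          ind = independent-resp {b = b} {tuple (tuple-code b)}
            (λ i → ≋-sym (tuple-tuple-code b i)) (proj₁ (proj₂ (independent-vectors U∈P)))

          k : Fin m
          k = index {tuple-code b} ind

          tuple≋b : ∀ i → tuple (at k) i ≋ b i
          tuple≋b i = ≡.subst (λ l → tuple l i ≋ b i)
            (≡.sym (at-index {tuple-code b} ind)) (tuple-tuple-code b i)

    finiteFamily : FiniteFamily P
    finiteFamily = finiteFamily-from (vector-size V-size t)
      (enumerate (λ k → independent? (Inverse.to (vector-size V-size t) k)))

-- Counting modulo a power of q

module Divisibility {c ℓ₁ ℓ₂ p} (F : HeytingField c ℓ₁ ℓ₂) {q} (1<q : 1 < q)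
    (F-size : HasSize (fieldSetoid F) q) (v : ℕ) (0<v : 0 < v) {t k : ℕ} (t<k : t < k)
    (P : Pred (VectorSpace.Subspace F v) p) (P-partition : VectorSpace.IsPartition F v t P)
    (nontrivial : ¬ VectorSpace.IsTrivial F v t P)
    (gap : ∀ i → t < i → i < k → ∀ U → P U → ¬ VectorSpace.HasDim F v U i) where

  open VectorSpace F v
  open LinearAlgebra F v
  open FiniteSpace F 1<q F-size v
  open Hyperplanes F 1<q F-size v
  open CommutativeRing (fieldRing F) hiding (zero)
  open IsPartition P-partition
  open FiniteFamilies F 1<q F-size v

  instance
    q-nonZero : NonZero q
    q-nonZero = ℕ.>-nonZero (ℕ.<-trans ℕ.z<s 1<q)

  k≤dim : ∀ {U d} → P U → HasDim U d → t ≤ d → d ≢ t → k ≤ d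
  k≤dim {U} {d} U∈P U-dim t≤d d≢t =
    ℕ.≮⇒≥ λ d<k → gap d (ℕ.≤∧≢⇒< t≤d (d≢t ∘ ≡.sym)) d<k U U∈P U-dim

  -- If `v < k`, an element of dimension other than `t` would have dimension at least `k`, more than
  -- the whole space allows. All elements would then have dimension `t`, and `P` would be trivial.
  k≤v : k ≤ v
  k≤v = ℕ.≮⇒≥ λ v<k → nontrivial λ {U} U∈P → inj₁ (trivial v<k U∈P (dimension U∈P))
    where
    trivial : ∀ {U} → v < k → P U → (∃ λ d → HasDim U d × t ≤ d) → HasDim U t
    trivial {U} v<k U∈P (d , U-dim , t≤d) with d ℕ.≟ t
    ... | yes d≡t = ≡.subst (HasDim U) d≡t U-dim
    ... | no d≢t  = contradiction (ℕ.≤-trans (k≤dim U∈P U-dim t≤d d≢t) (dim-≤ U-dim)) (ℕ.<⇒≱ v<k)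

  module _ (family : FiniteFamily P) (H : Subspace) (H-dim : IsHyperplane H)
           (L : LinearForm) (L-kernel : LinearForm.IsKernel L H) where

    open FiniteFamily family
    open LinearForm L using () renaming (⟨_⟩ to φ)

    dim : Fin size → ℕ
    dim i = proj₁ (dimension (element∈P i))

    element-dim : ∀ i → HasDim (element i) (dim i)
    element-dim i = proj₁ (proj₂ (dimension (element∈P i)))

    t≤dim : ∀ i → t ≤ dim i
    t≤dim i = proj₂ (proj₂ (dimension (element∈P i)))

    H⇒φ≈0 : ∀ {x} → Member H x → φ x ≈ 0#
    H⇒φ≈0 = proj₁ L-kernel

    _∈?_ : ∀ x i → Dec (Member (element i) x)
    x ∈? i = member? (element-dim i) x

    ⊑H? : ∀ i → Dec (element i ⊑ H)
    ⊑H? i = ⊑-dec {U = H} (element-dim i) (member? H-dim)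

    -- The two elements have the same intersection with H.
    _~_ : Rel (Fin size) _
    i ~ j = ∀ x → φ x ≈ 0# → (Member (element i) x → Member (element j) x) ×
                             (Member (element j) x → Member (element i) x)

    ~-isDecEquivalence : IsDecEquivalence _~_
    ~-isDecEquivalence = record
      { isEquivalence = record
        { refl  = λ _ _ → id , id
        ; sym   = λ i~j x φx≈0 → let f , g = i~j x φx≈0 in g , f
        ; trans = λ i~j j~k x φx≈0 → let f , g = i~j x φx≈0 ; f′ , g′ = j~k x φx≈0 in f′ ∘ f , g ∘ g′
        }
      ; _≟_ = λ i j → all-dec V-size
          (λ x≋y agree φy≈0 → let f , g = agree (trans (LinearForm.cong L x≋y) φy≈0) in
            transport i j x≋y f , transport j i x≋y g)
          λ x → φ x ≈? 0# →-dec ((x ∈? i →-dec x ∈? j) ×-dec (x ∈? j →-dec x ∈? i))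
      }
      where
      transport : ∀ i j {x y} → x ≋ y → (Member (element i) x → Member (element j) x) →
                  Member (element i) y → Member (element j) y
      transport i j x≋y f y∈i =
        Subspace.resp (element j) x≋y (f (Subspace.resp (element i) (≋-sym x≋y) y∈i))

    open IsDecEquivalence ~-isDecEquivalence using () renaming (_≟_ to _~?_)

    -- The number of these is the difference of the two sizes compared in `Divisible`.
    Outside : Pred (Fin size) _
    Outside i = dim i ≡ t × ¬ element i ⊑ H

    Outside? : Decidable Outside
    Outside? i = dim i ℕ.≟ t ×-dec ¬? (⊑H? i)

    module _ {i} (T-dim : HasDim (element i) t) {x₀}
             (x₀∈T : Member (element i) x₀) (φx₀≈1 : φ x₀ ≈ 1#) where

      open Transvections L (proj₂ T-dim) x₀∈T φx₀≈1

      τT⊑? : ∀ y j → Dec (τT y ⊑ element j)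
      τT⊑? y j = ⊑-dec {U = element j} (τT-dim y) (member? (element-dim j))

      count : Fin size → ℕ
      count j = ∑[ y < q ^ v ] ⟦ τT⊑? (vec y) j ⟧

      count≡q^dim : ∀ j → (∀ {z} → Member (element i) z → φ z ≈ 0# → Member (element j) z) →
                    ∀ {u} → Member (element j) u → φ u ≈ 1# → count j ≡ q ^ dim j
      count≡q^dim j T∩ker⊑ u∈ φu≈1 =
        τT-count {U = element j} (element-dim j) T∩ker⊑ u∈ φu≈1 (λ y → τT⊑? y j)

      count≡0 : ∀ j → (∀ y → ¬ τT (vec y) ⊑ element j) → count j ≡ 0
      count≡0 j none = sum-zero {q ^ v} _ λ y → ⟦⟧-false (τT⊑? (vec y) j) (none y)

      -- After exchanging the sums, each `y` contributes 1, because `covers-once` puts `τT y` into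
      -- exactly one element.
      ∑count : ∑[ j < size ] count j ≡ q ^ v
      ∑count = ≡.trans (∑-comm {size} {q ^ v} _)
        (≡.trans (sum-cong-≗ {q ^ v} λ y → unique (vec y)) (sum-one (q ^ v)))
        where
        unique : ∀ y → ∑[ j < size ] ⟦ τT⊑? y j ⟧ ≡ 1
        unique y =
          let U , (U∈P , τT⊑U) , U-unique = covers-once (τT y) (τT-dim y)
              j , j⊑U , U⊑j = find U∈P
          in sum-unique (τT⊑? y) j (λ {x} τTx → U⊑j (τT⊑U τTx)) λ {l} τT⊑l →
            let U⊑l , l⊑U = U-unique {element l} (element∈P l , λ {x} → τT⊑l {x})
            in element-injective ((λ {x} jx → U⊑l (j⊑U jx)) , λ {x} lx → U⊑j (l⊑U lx))

      -- If some `τT y` lies in `element j`, it brings along the kernel vectors of `element i` and a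
      -- point of value 1, as `count≡q^dim` requires; the exponent is at least `k` by `k≤dim`.
      -- Otherwise the count is 0.
      count-large : ∀ j → dim j ≢ t → q ^ k ∣ count j
      count-large j dimⱼ≢t with any? (λ y → τT⊑? (vec y) j)
      ... | no none = ≡.subst (q ^ k ∣_)
        (≡.sym (count≡0 j λ y τT⊑j → none (y , λ {x} → τT⊑j {x}))) (_ ∣0)
      ... | yes (y , τT⊑j) = ≡.subst (q ^ k ∣_)
        (≡.sym (count≡q^dim j (λ z∈T φz≈0 → τT⊑j (T∩ker⊑τT (vec y) z∈T φz≈0))
          (τT⊑j (point∈τT (vec y))) (φ-point (vec y))))
        (^-∣-^ q (k≤dim (element∈P j) (element-dim j) (t≤dim j) dimⱼ≢t))

      -- A `τT y` inside an element of the same dimension equals it, so that element meets the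
      -- kernel as `element i` does and leaves `H` at `point y`. Conversely, an element outside `H`
      -- has a vector of value 1 by `form≈1`, and `count≡q^dim` applies.
      count-small : ∀ j → dim j ≡ t → (w? : Dec (Outside j × i ~ j)) → count j ≡ q ^ t ℕ.* ⟦ w? ⟧
      count-small j dimⱼ≡t (yes ((_ , j⋢H) , i~j)) =
        let u , u∈j , φu≈1 = form≈1 L {H} L-kernel (element-dim j) j⋢H in
        ≡.trans (count≡q^dim j (λ {z} z∈T φz≈0 → proj₁ (i~j z φz≈0) z∈T) u∈j φu≈1)
          (≡.trans (≡.cong (q ^_) dimⱼ≡t) (≡.sym (ℕ.*-identityʳ (q ^ t))))
      count-small j dimⱼ≡t (no ¬w) = ≡.trans (count≡0 j none) (≡.sym (ℕ.*-zeroʳ (q ^ t)))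
        where
        1≉0 : ¬ 1# ≈ 0#
        -- If 1 were 0, then 0 would be invertible and hence apart from itself.
        1≉0 1≈0 = HeytingField.#-irrefl F refl (HeytingField.invertible⇒# F
          (0# , trans (zeroˡ _) (sym 1≈0) , trans (zeroʳ (0# - 0#)) (sym 1≈0)))

        none : ∀ y → ¬ τT (vec y) ⊑ element j
        none y τT⊑j = ¬w
          ( (dimⱼ≡t , λ j⊑H → 1≉0 (trans (sym (φ-point (vec y)))
                                         (H⇒φ≈0 (j⊑H (τT⊑j (point∈τT (vec y)))))))
          , λ x φx≈0 → (λ x∈T → τT⊑j (T∩ker⊑τT (vec y) x∈T φx≈0))
                     , λ x∈j → τT∩ker⊑T (vec y) (j⊑τT x∈j) φx≈0 )
          where
          j⊑τT : element j ⊑ τT (vec y)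
          j⊑τT = ⊑-same-dim {T = τT (vec y)} {U = element j} (τT-dim (vec y))
            (≡.subst (HasDim (element j)) dimⱼ≡t (element-dim j)) τT⊑j

      -- One formula for both kinds of element, ready to be summed over `j`. For dimensions other
      -- than `t` the bracket vanishes, since `Outside` demands dimension `t`.
      count-mod : ∀ j → ∃ λ m → count j ≡ m ℕ.* q ^ k ℕ.+ q ^ t ℕ.* ⟦ Outside? j ×-dec (i ~? j) ⟧
      count-mod j with dim j ℕ.≟ t
      ... | yes dimⱼ≡t = 0 , count-small j dimⱼ≡t (Outside? j ×-dec (i ~? j))
      ... | no dimⱼ≢t  = let divides m count≡ = count-large j dimⱼ≢t in
        m , ≡.trans count≡ (≡.sym (≡.trans (≡.cong (λ x → m ℕ.* q ^ k ℕ.+ q ^ t ℕ.* x)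
              (⟦⟧-false (Outside? j ×-dec (i ~? j)) (dimⱼ≢t ∘ proj₁ ∘ proj₁)))
            (≡.trans (≡.cong (m ℕ.* q ^ k ℕ.+_) (ℕ.*-zeroʳ (q ^ t))) (ℕ.+-identityʳ _))))

      -- Summing `count-mod` writes `q ^ v` as a multiple of `q ^ k` plus `q ^ t` times the size of
      -- the class. As `k ≤ v`, the last term is divisible by `q ^ k`, and `q ^ t` cancels.
      class-divisible : q ^ (k ∸ t) ∣ ∑[ j < size ] ⟦ Outside? j ×-dec (i ~? j) ⟧
      class-divisible = *-cancelˡ-∣ (q ^ t) {{ℕ.m^n≢0 q t}} (≡.subst₂ _∣_ (^-split q (ℕ.<⇒≤ t<k))
          (≡.sym (*-distribˡ-sum {size} (q ^ t) _))
          (∣m+n∣m⇒∣n (≡.subst (q ^ k ∣_) (≡.trans (≡.sym ∑count) split) (^-∣-^ q k≤v))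
            (∣-sum {size} _ λ j → n∣m*n (proj₁ (count-mod j)))))
        where
        split : ∑[ j < size ] count j ≡ ∑[ j < size ] (proj₁ (count-mod j) ℕ.* q ^ k)
                                    ℕ.+ ∑[ j < size ] (q ^ t ℕ.* ⟦ Outside? j ×-dec (i ~? j) ⟧)
        split = ≡.trans (sum-cong-≗ {size} λ j → proj₂ (count-mod j)) (∑-distrib-+ {size} _ _)

    outside-divisible : q ^ (k ∸ t) ∣ ∑[ i < size ] ⟦ Outside? i ⟧
    outside-divisible = ∣-sum-classes ~-isDecEquivalence Outside? λ i (dimᵢ≡t , i⋢H) →
      let T-dim = ≡.subst (HasDim (element i)) dimᵢ≡t (element-dim i)
          _ , x₀∈T , φx₀≈1 = form≈1 L {H} L-kernel T-dim i⋢H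
      in class-divisible T-dim x₀∈T φx₀≈1

    N? : Decidable (λ i → dim i ≡ t)
    N? i = dim i ℕ.≟ t

    -- `dim i` is whichever dimension the field `dimension` supplies; `dim-unique` identifies it
    -- with the one asserted by `ofDim P t`.
    dim-N : ∀ {U} i → ofDim P t U → element i ≐ U → dim i ≡ t
    dim-N i (_ , U-dim) i≐U = dim-unique (HasDim-resp {U = element i} i≐U (element-dim i)) U-dim

    N∋ : ∀ i → dim i ≡ t → ofDim P t (element i)
    N∋ i dimᵢ≡t = element∈P i , ≡.subst (HasDim (element i)) dimᵢ≡t (element-dim i)

    N-size : HasSize (members (ofDim P t)) (∑[ i < size ] ⟦ N? i ⟧)
    N-size = members-size (ofDim P t) N? proj₁ N∋ dim-N

    N-within-size : HasSize (members (within (ofDim P t) H)) (∑[ i < size ] ⟦ N? i ×-dec ⊑H? i ⟧)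
    N-within-size = members-size (within (ofDim P t) H) (λ i → N? i ×-dec ⊑H? i) (proj₁ ∘ proj₁)
      (λ i (dimᵢ≡t , i⊑H) → N∋ i dimᵢ≡t , λ {x} → i⊑H {x})
      (λ i (U∈N , U⊑H) i≐U → dim-N i U∈N i≐U , λ {x} x∈i → U⊑H (proj₁ i≐U x∈i))

    N-split : ∑[ i < size ] ⟦ N? i ⟧ ≡ ∑[ i < size ] ⟦ N? i ×-dec ⊑H? i ⟧ ℕ.+ ∑[ i < size ] ⟦ Outside? i ⟧
    N-split = ≡.trans (sum-cong-≗ {size} λ i → ⟦⟧-split (N? i) (⊑H? i)) (∑-distrib-+ {size} _ _)

    congruent : CongruentMod (q ^ (k ∸ t))
                  (∑[ i < size ] ⟦ N? i ⟧) (∑[ i < size ] ⟦ N? i ×-dec ⊑H? i ⟧)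
    -- By `N-split` the distance has the form of a sum minus its first summand, which leaves the
    -- number of outside elements.
    congruent = ≡.subst (q ^ (k ∸ t) ∣_) (≡.sym (≡.trans (≡.cong (λ m → ∣ m - n∩H ∣) N-split)
        (≡.trans (ℕ.∣-∣-comm (n∩H ℕ.+ _) n∩H) (ℕ.∣m-m+n∣≡n n∩H _)))) outside-divisible
      where
      n∩H : ℕ
      n∩H = ∑[ i < size ] ⟦ N? i ×-dec ⊑H? i ⟧

  divisible : Divisible (q ^ (k ∸ t)) (ofDim P t)
  divisible H H-dim =
    let family = finiteFamily P-partition
        L , L-kernel = hyperplane-form 0<v H-dim
    in _ , _ , N-size family H H-dim L L-kernel , N-within-size family H H-dim L L-kernel ,
       congruent family H H-dim L L-kernel

primePower>1 : ∀ {q} → IsPrimePower q → 1 < q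
primePower>1 (p , e , p-prime , 0<e , ≡.refl) =
  ℕ.^-monoʳ-< p (ℕ.nonTrivial⇒n>1 p {{prime⇒nonTrivial p-prime}}) 0<e

proposition4p2 : ∀ {c ℓ₁ ℓ₂ p} (q v t k : ℕ) → IsPrimePower q → 0 < v → 0 < t → t < k →
    (F : HeytingField c ℓ₁ ℓ₂) → HasSize (fieldSetoid F) q →
    let open VectorSpace F v in
    (P : Pred Subspace p) → IsPartition t P → ¬ IsTrivial t P →
    (∀ i → t < i → i < k → ∀ U → P U → ¬ HasDim U i) →
    Divisible (q ^ (k ∸ t)) (ofDim P t)
proposition4p2 q v t k q-pp 0<v _ t<k F F-size P P-partition nontrivial gap =
  Divisibility.divisible F (primePower>1 q-pp) F-size v 0<v t<k P P-partition nontrivial gap
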